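{- Let $A,B,C$ be finite sets. If $\lambda \in \mathrm{Exch}(2^A, 2^B)$ and $\mu \in \mathrm{Exch}(2^B, 2^C)$, then $\lambda \circ \mu \in \mathrm{Exch}(2^A, 2^C)$.
   Context: For a finite set $E$, $2^E$ is the set of subsets of $E$. Complements $\overline X$ are taken in the ambient set ($\overline X = A\setminus X$ for $X\subseteq A$, $\overline Y = B \setminus Y$ for $Y \subseteq B$). $A\sqcup B$ is the disjoint union (in particular $A$ and $B$ are treated as disjoint inside $A \sqcup B$ even if $A=B$), and subsets of $A \sqcup B$ are identified with pairs of subsets of $A$ and $B$. $\mathrm{Rel}(2^A,2^B)$ is the set of all binary relations $\lambda \subseteq 2^A\times 2^B$ (including the empty relation); $X\mapsto_\lambda Y$ means $(X,Y)\in\lambda$. Composition is in diagrammatic order: $X\mapsto_{\lambda\circ\mu} Z$ iff there is $Y \in 2^B$ with $X\mapsto_\lambda Y$ and $Y\mapsto_\mu Z$. Given $X\mapsto_\lambda Y$ and $u,v\in A\sqcup B$, say $u$ and $v$ are exchangeable in $X\mapsto_\lambda Y$ if either $u=v$, or exactly one of $u,v$ belongs to $\overline X\sqcup Y$ and $X'\mapsto_\lambda Y'$, where $X' = X\,\triangle\,(\{u,v\}\cap A)$ and $Y'=Y\,\triangle\,(\{u,v\}\cap B)$ ($\triangle$ is symmetric difference). $\lambda\in \mathrm{Rel}(2^A,2^B)$ satisfies the exchange axiom if for all $X\mapsto_\lambda Y$, $X'\mapsto_\lambda Y'$ and all $u\in\overline X\sqcup Y$ there exists $v\in\overline{X'}\sqcup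 Y'$ such that $u$ and $v$ are exchangeable in $X\mapsto_\lambda Y$. $\mathrm{Exch}(2^A,2^B)$ is the set of all relations in $\mathrm{Rel}(2^A,2^B)$ satisfying the exchange axiom (the empty relation is included). Equivalently, $\{\overline X\sqcup Y : X\mapsto_\lambda Y\}$ is either empty or the set of bases of a matroid on $A\sqcup B$. -}

module Defs where

open import Data.Bool.Base using (_xor_)
open import Data.Fin.Base using (Fin)
open import Data.Fin.Subset using (Subset; ⊥; ⁅_⁆; ∁; _∪_; _∈_)
open import Data.Nat.Base using (ℕ)
open import Data.Product.Base using (_×_; _,_; proj₁; proj₂; ∃)
open import Data.Sum.Base using (_⊎_; inj₁; inj₂)
open import Data.Vec.Base using (zipWith)
open import Level using (Level)
open import Relation.Binary.Construct.Composition public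
  using () renaming (_;_ to infixr 9 _⨾_)
open import Relation.Binary.Core using (REL)
open import Relation.Binary.PropositionalEquality.Core using (_≡_)
open import Relation.Nullary.Negation.Core using (¬_)

private
  variable
    m n : ℕ
    ℓ : Level

infixl 6 _△_

_△_ : Subset n → Subset n → Subset n
p △ q = zipWith _xor_ p q

-- The finite sets are A = Fin m and B = Fin n, and the disjoint union A ⊔ B
-- is Fin m ⊎ Fin n. A subset of A ⊔ B is the pair of its intersections with
-- A and B, so that proj₁ and proj₂ are the operations _ ∩ A and _ ∩ B.

Subset⊔ : ℕ → ℕ → Set
Subset⊔ m n = Subset m × Subset n

infix 4 _∈⊔_ _∉⊔_

_∈⊔_ : Fin m ⊎ Fin n → Subset⊔ m n → Set
inj₁ i ∈⊔ (P , Q) = i ∈ P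
inj₂ j ∈⊔ (P , Q) = j ∈ Q

_∉⊔_ : Fin m ⊎ Fin n → Subset⊔ m n → Set
u ∉⊔ S = ¬ (u ∈⊔ S)

infixr 6 _∪⊔_

_∪⊔_ : Subset⊔ m n → Subset⊔ m n → Subset⊔ m n
(P , Q) ∪⊔ (P′ , Q′) = P ∪ P′ , Q ∪ Q′

⁅_⁆⊔ : Fin m ⊎ Fin n → Subset⊔ m n
⁅ inj₁ i ⁆⊔ = ⁅ i ⁆ , ⊥
⁅ inj₂ j ⁆⊔ = ⊥ , ⁅ j ⁆

pair : Fin m ⊎ Fin n → Fin m ⊎ Fin n → Subset⊔ m n
pair u v = ⁅ u ⁆⊔ ∪⊔ ⁅ v ⁆⊔

ExactlyOneIn : Fin m ⊎ Fin n → Fin m ⊎ Fin n → Subset⊔ m n → Set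
ExactlyOneIn u v S = (u ∈⊔ S × v ∉⊔ S) ⊎ (u ∉⊔ S × v ∈⊔ S)

Exchangeable : (L : REL (Subset m) (Subset n) ℓ) (X : Subset m) (Y : Subset n) →
               (u v : Fin m ⊎ Fin n) → Set ℓ
Exchangeable L X Y u v =
  u ≡ v ⊎
  (ExactlyOneIn u v (∁ X , Y) ×
   L (X △ proj₁ (pair u v)) (Y △ proj₂ (pair u v)))

ExchangeAxiom : REL (Subset m) (Subset n) ℓ → Set ℓ
ExchangeAxiom L =
  ∀ {X Y X′ Y′} → L X Y → L X′ Y′ →
  ∀ u → u ∈⊔ (∁ X , Y) →
  ∃ λ v → v ∈⊔ (∁ X′ , Y′) × Exchangeable L X Y u v

{-# OPTIONS --safe #-}

-- Write S = ∁ X ⊔ Y and T = ∁ Y ⊔ Z for the bases of L and M behind X ↦ Z, and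
-- S′, T′ for those behind X′ ↦ Z′. Exchanging u out of S (or T) towards S′ (T′)
-- brings in some v. If v lies in the middle set B, then S and T are no longer
-- complementary on B, and this is repaired by exchanging v out of the other
-- basis, and so on alternately. Every step inside B moves Y closer to Y′, so
-- eventually the element brought in lies in A or C.

module Submission where

open import Defs
open import Data.Bool.Base using (true; false; not)
open import Data.Bool.Properties using (xor-identityʳ)
open import Data.Empty using (⊥-elim)
open import Data.Fin.Base using (Fin; zero; suc)
open import Data.Fin.Subset using (Subset; ⊥; ⁅_⁆; ∁; _∪_; _∈_; _∉_; ∣_∣)
open import Data.Fin.Subset.Properties
  using (_∈?_; ∪-identityˡ; ∪-identityʳ; x∈∁p⇒x∉p; x∉p⇒x∈∁p; x∈p⇒x∉∁p; x∉∁p⇒x∈p)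
open import Data.Nat.Base using (ℕ; suc; _<_)
open import Data.Nat.Induction using (Acc; acc; <-wellFounded)
open import Data.Nat.Properties using (≤-reflexive)
open import Data.Product.Base using (_×_; _,_; ∃; uncurry)
open import Data.Sum.Base using (_⊎_; inj₁; inj₂)
open import Data.Vec.Base using (_∷_; lookup; updateAt)
open import Data.Vec.Properties
  using ([]=⇒lookup; lookup⇒[]=; lookup∘updateAt′; updateAt-minimal; zipWith-identityʳ)
open import Function.Base using (_∘_)
open import Level using (Level)
open import Relation.Binary.Core using (REL)
open import Relation.Binary.PropositionalEquality
  using (_≡_; _≢_; refl; sym; trans; cong; cong₂; subst)
open import Relation.Nullary using (Dec; yes; no)

private
  variable
    m n : ℕ
    ℓ ℓ₁ ℓ₂ : Level

-- Single bit flips replace symmetric differences with unions of singletons, so membership reduces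
-- to facts about `updateAt`.
toggle : Fin n → Subset n → Subset n
toggle i p = updateAt p i not

∈-toggle⁺ : ∀ {i j} {p : Subset n} → i ≢ j → i ∈ p → i ∈ toggle j p
∈-toggle⁺ {i = i} {j} {p} i≢j = updateAt-minimal i j p i≢j

∈-toggle⁻ : ∀ {i j} {p : Subset n} → i ≢ j → i ∈ toggle j p → i ∈ p
∈-toggle⁻ {i = i} {j} {p} i≢j i∈ =
  lookup⇒[]= i p (trans (sym (lookup∘updateAt′ i j i≢j p)) ([]=⇒lookup i∈))

∈∉⇒≢ : ∀ {i j} {p : Subset n} → i ∈ p → j ∉ p → i ≢ j
∈∉⇒≢ i∈p j∉p refl = j∉p i∈p

∈∉⇒lookup≢ : ∀ {i} {p q : Subset n} → i ∈ p → i ∉ q → lookup p i ≢ lookup q i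
∈∉⇒lookup≢ {i = i} {q = q} i∈p i∉q eq =
  i∉q (lookup⇒[]= i q (trans (sym eq) ([]=⇒lookup i∈p)))

△-⊥ : (p : Subset n) → p △ ⊥ ≡ p
△-⊥ = zipWith-identityʳ xor-identityʳ

△-⁅⁆ : (p : Subset n) (i : Fin n) → p △ ⁅ i ⁆ ≡ toggle i p
△-⁅⁆ (true  ∷ p) zero    = cong (false ∷_) (△-⊥ p)
△-⁅⁆ (false ∷ p) zero    = cong (true ∷_) (△-⊥ p)
△-⁅⁆ (x     ∷ p) (suc i) = cong₂ _∷_ (xor-identityʳ x) (△-⁅⁆ p i)

-- For i = j the two sides differ: the union collapses to a singleton, while two flips cancel.
△-pair : (p : Subset n) {i j : Fin n} → i ≢ j →
         p △ (⁅ i ⁆ ∪ ⁅ j ⁆) ≡ toggle j (toggle i p)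
△-pair p {zero} {zero} i≢j = ⊥-elim (i≢j refl)
△-pair (true  ∷ p) {zero} {suc j} i≢j =
  cong (false ∷_) (trans (cong (p △_) (∪-identityˡ ⁅ j ⁆)) (△-⁅⁆ p j))
△-pair (false ∷ p) {zero} {suc j} i≢j =
  cong (true ∷_) (trans (cong (p △_) (∪-identityˡ ⁅ j ⁆)) (△-⁅⁆ p j))
△-pair (true  ∷ p) {suc i} {zero} i≢j =
  cong (false ∷_) (trans (cong (p △_) (∪-identityʳ ⁅ i ⁆)) (△-⁅⁆ p i))
△-pair (false ∷ p) {suc i} {zero} i≢j =
  cong (true ∷_) (trans (cong (p △_) (∪-identityʳ ⁅ i ⁆)) (△-⁅⁆ p i))
△-pair (x ∷ p) {suc i} {suc j} i≢j =
  cong₂ _∷_ (xor-identityʳ x) (△-pair p (i≢j ∘ cong suc))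

-- The decreasing measure of the alternation. Comparing bits covers both adding an element of `q`
-- and removing an element outside it.
∣toggle△∣ : (p q : Subset n) (i : Fin n) → lookup p i ≢ lookup q i →
            suc ∣ toggle i p △ q ∣ ≡ ∣ p △ q ∣
∣toggle△∣ (true  ∷ p) (true  ∷ q) zero    p≢q = ⊥-elim (p≢q refl)
∣toggle△∣ (true  ∷ p) (false ∷ q) zero    p≢q = refl
∣toggle△∣ (false ∷ p) (true  ∷ q) zero    p≢q = refl
∣toggle△∣ (false ∷ p) (false ∷ q) zero    p≢q = ⊥-elim (p≢q refl)
∣toggle△∣ (true  ∷ p) (true  ∷ q) (suc i) p≢q = ∣toggle△∣ p q i p≢q
∣toggle△∣ (true  ∷ p) (false ∷ q) (suc i) p≢q = cong suc (∣toggle△∣ p q i p≢q)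
∣toggle△∣ (false ∷ p) (true  ∷ q) (suc i) p≢q = cong suc (∣toggle△∣ p q i p≢q)
∣toggle△∣ (false ∷ p) (false ∷ q) (suc i) p≢q = ∣toggle△∣ p q i p≢q

-- It acts on (X, Y) rather than on the basis (∁ X, Y); flipping a bit commutes with complement.
toggle⊔ : Fin m ⊎ Fin n → Subset⊔ m n → Subset⊔ m n
toggle⊔ (inj₁ i) (P , Q) = toggle i P , Q
toggle⊔ (inj₂ j) (P , Q) = P , toggle j Q

_∈⊔?_ : (u : Fin m ⊎ Fin n) (S : Subset⊔ m n) → Dec (u ∈⊔ S)
inj₁ i ∈⊔? (P , Q) = i ∈? P
inj₂ j ∈⊔? (P , Q) = j ∈? Q

∈∉⇒≢⊔ : ∀ {u v} (S : Subset⊔ m n) → u ∈⊔ S → v ∉⊔ S → u ≢ v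
∈∉⇒≢⊔ S u∈S v∉S refl = v∉S u∈S

△-pair⊔ : (X : Subset m) (Y : Subset n) (u v : Fin m ⊎ Fin n) → u ≢ v →
          let P , Q = pair u v in (X △ P , Y △ Q) ≡ toggle⊔ v (toggle⊔ u (X , Y))
△-pair⊔ X Y (inj₁ i) (inj₁ j) u≢v =
  cong₂ _,_ (△-pair X (u≢v ∘ cong inj₁))
            (trans (cong (Y △_) (∪-identityˡ ⊥)) (△-⊥ Y))
△-pair⊔ X Y (inj₁ i) (inj₂ j) u≢v =
  cong₂ _,_ (trans (cong (X △_) (∪-identityʳ ⁅ i ⁆)) (△-⁅⁆ X i))
            (trans (cong (Y △_) (∪-identityˡ ⁅ j ⁆)) (△-⁅⁆ Y j))
△-pair⊔ X Y (inj₂ i) (inj₁ j) u≢v =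
  cong₂ _,_ (trans (cong (X △_) (∪-identityˡ ⁅ j ⁆)) (△-⁅⁆ X j))
            (trans (cong (Y △_) (∪-identityʳ ⁅ i ⁆)) (△-⁅⁆ Y i))
△-pair⊔ X Y (inj₂ i) (inj₂ j) u≢v =
  cong₂ _,_ (trans (cong (X △_) (∪-identityˡ ⊥)) (△-⊥ X))
            (△-pair Y (u≢v ∘ cong inj₂))

∈-toggle⊔ : ∀ (X : Subset m) (Y : Subset n) {u v} → v ≢ u → v ∈⊔ (∁ X , Y) →
            let X₁ , Y₁ = toggle⊔ u (X , Y) in v ∈⊔ (∁ X₁ , Y₁)
∈-toggle⊔ X Y {inj₁ i} {inj₁ j} v≢u v∈ =
  x∉p⇒x∈∁p (x∈∁p⇒x∉p v∈ ∘ ∈-toggle⁻ (v≢u ∘ cong inj₁))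
∈-toggle⊔ X Y {inj₁ i} {inj₂ j} v≢u v∈ = v∈
∈-toggle⊔ X Y {inj₂ i} {inj₁ j} v≢u v∈ = v∈
∈-toggle⊔ X Y {inj₂ i} {inj₂ j} v≢u v∈ = ∈-toggle⁺ (v≢u ∘ cong inj₂) v∈

-- The usual basis exchange for matroids: u in S minus S′ is traded for v in S′ minus S, so the
-- trivial case u = v never arises.
StrictExchange : REL (Subset m) (Subset n) ℓ → Set ℓ
StrictExchange L =
  ∀ {X Y X′ Y′} → L X Y → L X′ Y′ →
  ∀ u → u ∈⊔ (∁ X , Y) → u ∉⊔ (∁ X′ , Y′) →
  ∃ λ v → v ∈⊔ (∁ X′ , Y′) × v ∉⊔ (∁ X , Y) ×
          uncurry L (toggle⊔ v (toggle⊔ u (X , Y)))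

exchange⇒strict : (L : REL (Subset m) (Subset n) ℓ) →
                  ExchangeAxiom L → StrictExchange L
exchange⇒strict L ex {X} {Y} XLY X′LY′ u u∈S u∉S′ with ex XLY X′LY′ u u∈S
... | v , v∈S′ , inj₁ refl = ⊥-elim (u∉S′ v∈S′)
... | v , v∈S′ , inj₂ (inj₂ (u∉S , _) , _) = ⊥-elim (u∉S u∈S)
... | v , v∈S′ , inj₂ (inj₁ (_ , v∉S) , XLY₁) =
  v , v∈S′ , v∉S ,
  subst (uncurry L) (△-pair⊔ X Y u v (∈∉⇒≢⊔ (∁ X , Y) u∈S v∉S)) XLY₁

strict⇒exchange : (L : REL (Subset m) (Subset n) ℓ) →
                  StrictExchange L → ExchangeAxiom L
strict⇒exchange L ex {X} {Y} {X′} {Y′} XLY X′LY′ u u∈S with u ∈⊔? (∁ X′ , Y′)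
... | yes u∈S′ = u , u∈S′ , inj₁ refl
... | no u∉S′ with ex XLY X′LY′ u u∈S u∉S′
... | v , v∈S′ , v∉S , XLY₁ =
  v , v∈S′ , inj₂ (inj₁ (u∈S , v∉S) ,
  subst (uncurry L) (sym (△-pair⊔ X Y u v (∈∉⇒≢⊔ (∁ X , Y) u∈S v∉S))) XLY₁)

module _ {a b c : ℕ}
         {L : REL (Subset a) (Subset b) ℓ₁} {M : REL (Subset b) (Subset c) ℓ₂}
         (exL : StrictExchange L) (exM : StrictExchange M)
         {X′ Y′ Z′} (X′LY′ : L X′ Y′) (Y′MZ′ : M Y′ Z′) where

  -- In its uses, u has already been removed from ∁ X ⊔ Z, and v fills the gap.
  Augmentation : Subset a → Subset c → Set _
  Augmentation X Z =
    ∃ λ v → v ∈⊔ (∁ X′ , Z′) × v ∉⊔ (∁ X , Z) × uncurry (L ⨾ M) (toggle⊔ v (X , Z))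

  -- The two middle sets differ only at j, which lies in both bases and so must leave that of `M`.
  -- Here `Y` is the side that lags behind: flipping j brings it closer to `Y′`.
  repairM : ∀ {X Y Z j} → Acc _<_ ∣ Y △ Y′ ∣ →
            L X (toggle j Y) → M Y Z → j ∉ Y → j ∈ Y′ → Augmentation X Z
  -- The mirror situation: i lies in both bases and must leave that of `L`, whose middle set `Y` now
  -- lags.
  repairL : ∀ {X Y Z i} → Acc _<_ ∣ Y △ Y′ ∣ →
            L X Y → M (toggle i Y) Z → i ∈ Y → i ∉ Y′ → Augmentation X Z

  repairM {Y = Y} {j = j} (acc rec) XLY YMZ j∉Y j∈Y′
    with exM YMZ Y′MZ′ (inj₁ j) (x∉p⇒x∈∁p j∉Y) (x∈p⇒x∉∁p j∈Y′)
  -- The element brought in lies in C, so both sides now share the middle set `toggle j Y`.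
  ... | inj₂ k , k∈Z′ , k∉Z , YMZ₁ = inj₂ k , k∈Z′ , k∉Z , _ , XLY , YMZ₁
  ... | inj₁ i , i∈∁Y′ , i∉∁Y , YMZ₁ =
    repairL (rec (≤-reflexive (∣toggle△∣ Y Y′ j (∈∉⇒lookup≢ j∈Y′ j∉Y ∘ sym))))
      XLY YMZ₁ (∈-toggle⁺ (∈∉⇒≢ i∈Y j∉Y) i∈Y) (x∈∁p⇒x∉p i∈∁Y′)
    where i∈Y = x∉∁p⇒x∈p i∉∁Y

  repairL {Y = Y} {i = i} (acc rec) XLY YMZ i∈Y i∉Y′
    with exL XLY X′LY′ (inj₂ i) i∈Y i∉Y′
  ... | inj₁ k , k∈∁X′ , k∉∁X , XLY₁ = inj₁ k , k∈∁X′ , k∉∁X , _ , XLY₁ , YMZ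
  ... | inj₂ j , j∈Y′ , j∉Y , XLY₁ =
    repairM (rec (≤-reflexive (∣toggle△∣ Y Y′ i (∈∉⇒lookup≢ i∈Y i∉Y′))))
      -- j and i are distinct because `Y′` contains only j, so flipping i leaves j outside.
      XLY₁ YMZ (j∉Y ∘ ∈-toggle⁻ (∈∉⇒≢ j∈Y′ i∉Y′)) j∈Y′

strict-⨾ : ∀ {a b c} {L : REL (Subset a) (Subset b) ℓ₁}
           {M : REL (Subset b) (Subset c) ℓ₂} →
           StrictExchange L → StrictExchange M → StrictExchange (L ⨾ M)
strict-⨾ exL exM {X} {Z} {X′} {Z′} (Y , XLY , YMZ) (Y′ , X′LY′ , Y′MZ′) (inj₁ k) k∈S k∉S′
  with exL XLY X′LY′ (inj₁ k) k∈S k∉S′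
... | inj₁ l , l∈S′ , l∉S , XLY₁ = inj₁ l , l∈S′ , l∉S , Y , XLY₁ , YMZ
... | inj₂ j , j∈Y′ , j∉Y , XLY₁
  with repairM exL exM X′LY′ Y′MZ′ (<-wellFounded _) XLY₁ YMZ j∉Y j∈Y′
... | v , v∈S′ , v∉S₁ , XZ₁ =
  -- The repair only keeps v out of S with u removed; v = u is excluded because u is not in S′.
  v , v∈S′ , v∉S₁ ∘ ∈-toggle⊔ X Z {inj₁ k} (∈∉⇒≢⊔ (∁ X′ , Z′) v∈S′ k∉S′) , XZ₁
strict-⨾ exL exM {X} {Z} {X′} {Z′} (Y , XLY , YMZ) (Y′ , X′LY′ , Y′MZ′) (inj₂ k) k∈S k∉S′
  with exM YMZ Y′MZ′ (inj₂ k) k∈S k∉S′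
... | inj₂ l , l∈S′ , l∉S , YMZ₁ = inj₂ l , l∈S′ , l∉S , Y , XLY , YMZ₁
... | inj₁ i , i∈∁Y′ , i∉∁Y , YMZ₁
  with repairL exL exM X′LY′ Y′MZ′ (<-wellFounded _) XLY YMZ₁
         (x∉∁p⇒x∈p i∉∁Y) (x∈∁p⇒x∉p i∈∁Y′)
... | v , v∈S′ , v∉S₁ , XZ₁ =
  v , v∈S′ , v∉S₁ ∘ ∈-toggle⊔ X Z {inj₂ k} (∈∉⇒≢⊔ (∁ X′ , Z′) v∈S′ k∉S′) , XZ₁

theorem2p15 : ∀ {ℓ₁ ℓ₂ : Level} (a b c : ℕ)
    (L : REL (Subset a) (Subset b) ℓ₁) (M : REL (Subset b) (Subset c) ℓ₂) →
    ExchangeAxiom L → ExchangeAxiom M → ExchangeAxiom (L ⨾ M)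
theorem2p15 a b c L M exL exM =
  strict⇒exchange (L ⨾ M) (strict-⨾ (exchange⇒strict L exL) (exchange⇒strict M exM))
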